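{- Let $\ell\ge3$ and $0\le i<\ell$. The $i$-signature (and hence the reduced $i$-signature) of an $\ell$-regular partition $\lambda$ (a node of $B(\Lambda_0)$) can be determined by reading from its leftmost ladder to its rightmost ladder, bottom to top on each ladder; that is, the word of $+$'s and $-$'s in the addable and removable $i$-boxes of $\lambda$ read in this order equals the $i$-signature of $\lambda$.
   Context: A partition is $\ell$-regular if it does not have $\ell$ or more equal nonzero parts. The position $(a,b)$ (row $a$, rows numbered downward; column $b$) has residue $b-a\bmod\ell$. A box of $\lambda$ of residue $i$ whose removal leaves a partition is a removable $i$-box (marked $-$); a position of residue $i$ not in $\lambda$ whose addition gives a partition is an addable $i$-box (marked $+$). The (classical) $i$-signature of $\lambda$ is the word of these $+$'s and $-$'s read from bottom left to top right (i.e. from the bottom row to the top row); the reduced $i$-signature is obtained by repeatedly deleting adjacent pairs $-+$. The ladder of $(a,b)$ is the set of positions $(c,d)$, $c,d\ge1$, with $c-a=(\ell-1)(b-d)$. Ladders are ordered left to right, i.e. by increasing value of $a+(\ell-1)(b-1)$. -}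

module Defs where

open import Data.Empty using (⊥-elim)
open import Data.Integer as ℤ using (_⊖_; _%ℕ_; 1ℤ)
import Data.Integer.Properties as ℤₚ
open import Data.Integer.Tactic.RingSolver using (solve-∀)
open import Data.List.Base using (List; []; _∷_; _++_; map; filter; length; concatMap; cartesianProduct; upTo; downFrom)
open import Data.List.Membership.Propositional using (_∈_)
open import Data.List.Membership.Propositional.Properties
  using (∈-map⁺; ∈-map⁻; ∈-upTo⁺; ∈-upTo⁻; ∈-downFrom⁺; ∈-downFrom⁻;
         ∈-cartesianProduct⁺; ∈-cartesianProduct⁻; ∈-filter⁺; ∈-filter⁻; ∈-concatMap⁺)
open import Data.List.Relation.Unary.All using (All; []; _∷_)
open import Data.List.Relation.Unary.Any as Any using (here; there)
open import Data.List.Relation.Unary.Linked using (Linked; []; [-]; _∷_)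
open import Data.Nat.Base
open import Data.Nat.Properties
open import Data.Product.Base using (Σ; ∃; _×_; _,_; proj₁; proj₂)
open import Data.Sign.Base using (Sign)
open import Data.Sum.Base using (_⊎_; inj₁; inj₂)
open import Function.Bundles using (_⇔_; mk⇔; Equivalence)
open import Relation.Binary.Construct.Closure.ReflexiveTransitive using (Star)
open import Relation.Binary.PropositionalEquality
  using (_≡_; _≢_; refl; sym; trans; cong; subst)
open import Relation.Nullary using (¬_; Dec; yes; no)
open import Relation.Nullary.Decidable using (map′; _×-dec_; _⊎-dec_)

record Partition : Set where
  constructor mkPartition
  field
    parts      : List ℕ
    decreasing : Linked _≥_ parts
    positive   : All (1 ≤_) parts

open Partition public

Regular : ℕ → Partition → Set
Regular ℓ μ = ∀ k → 1 ≤ k → length (filter (k ≟_) (parts μ)) < ℓ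

-- (a , b) is row a, column b; both are counted from 1, row 1 on top.
Position : Set
Position = ℕ × ℕ

-- The a-th part, a ≥ 1; it is 0 beyond the last part and (so that there is no
-- row 0) at a = 0.
nth : List ℕ → ℕ → ℕ
nth _        zero          = 0
nth []       (suc _)       = 0
nth (x ∷ _)  (suc zero)    = x
nth (_ ∷ xs) (suc (suc a)) = nth xs (suc a)

part : Partition → ℕ → ℕ
part μ = nth (parts μ)

-- This forces a ≥ 1, since part μ 0 = 0.
_∈ᵈ_ : Position → Partition → Set
(a , b) ∈ᵈ μ = 1 ≤ b × b ≤ part μ a

Removable : Partition → Position → Set
Removable μ p = p ∈ᵈ μ × ∃ λ ν → ∀ q → q ∈ᵈ ν ⇔ (q ∈ᵈ μ × q ≢ p)

-- The position is automatically a genuine one (a, b ≥ 1), as it belongs to ν.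
Addable : Partition → Position → Set
Addable μ p = ¬ (p ∈ᵈ μ) × ∃ λ ν → ∀ q → q ∈ᵈ ν ⇔ (q ∈ᵈ μ ⊎ q ≡ p)

-- Removable and Addable in terms of the parts; used only to decide them.

RemovableCorner : Partition → Position → Set
RemovableCorner μ (a , b) = 1 ≤ b × b ≡ part μ a × part μ (suc a) < b

AddableCorner : Partition → Position → Set
AddableCorner μ (a , b) = 1 ≤ a × b ≡ suc (part μ a) × (a ≡ 1 ⊎ b ≤ part μ (pred a))

private

  nth-antitone : ∀ {xs} → Linked _≥_ xs → ∀ a → nth xs (suc (suc a)) ≤ nth xs (suc a)
  nth-antitone []       a       = z≤n
  nth-antitone [-]      zero    = z≤n
  nth-antitone [-]      (suc a) = z≤n
  nth-antitone (r ∷ rs) zero    = r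
  nth-antitone (_ ∷ rs) (suc a) = nth-antitone rs a

  nth-head : ∀ {xs} → Linked _≥_ xs → ∀ a → nth xs a ≤ nth xs 1
  nth-head l zero          = z≤n
  nth-head l (suc zero)    = ≤-refl
  nth-head l (suc (suc a)) = ≤-trans (nth-antitone l a) (nth-head l (suc a))

  nth-beyond : ∀ xs a → length xs ≤ a → nth xs (suc a) ≡ 0
  nth-beyond []       a       _       = refl
  nth-beyond (_ ∷ xs) (suc a) (s≤s h) = nth-beyond xs a h

  antitone-part : ∀ μ a → part μ (suc (suc a)) ≤ part μ (suc a)
  antitone-part μ = nth-antitone (decreasing μ)

  Antitone : (ℕ → ℕ) → Set
  Antitone g = ∀ c → g (suc c) ≤ g c

  fromFun : ∀ g → Antitone g → ∀ n → g n ≡ 0 → Σ Partition λ ν → ∀ c → part ν (suc c) ≡ g c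
  fromFun g anti zero gz = mkPartition [] [] [] , λ c → sym (vanish c)
    where
    vanish : ∀ c → g c ≡ 0
    vanish zero    = gz
    vanish (suc c) = n≤0⇒n≡0 (subst (g (suc c) ≤_) (vanish c) (anti c))
  fromFun g anti (suc n) gz with g 0 in eq
  ... | zero = mkPartition [] [] [] , λ c → sym (vanish c)
    where
    vanish : ∀ c → g c ≡ 0
    vanish zero    = eq
    vanish (suc c) = n≤0⇒n≡0 (subst (g (suc c) ≤_) (vanish c) (anti c))
  ... | suc k with fromFun (λ c → g (suc c)) (λ c → anti (suc c)) n gz
  ...   | mkPartition xs l pos , rows =
            mkPartition (suc k ∷ xs) (link xs l (rows 0)) (s≤s z≤n ∷ pos) , rows′
    where
    link : ∀ ys → Linked _≥_ ys → nth ys 1 ≡ g 1 → Linked _≥_ (suc k ∷ ys)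
    link []       _  _ = [-]
    link (y ∷ ys) l′ h = subst (_≤ suc k) (sym h) (subst (g 1 ≤_) eq (anti 0)) ∷ l′

    rows′ : ∀ c → nth (suc k ∷ xs) (suc c) ≡ g c
    rows′ zero    = sym eq
    rows′ (suc c) = rows c

  left-closed : ∀ ν a b → (a , suc (suc b)) ∈ᵈ ν → (a , suc b) ∈ᵈ ν
  left-closed ν _ _ (_ , h) = s≤s z≤n , ≤-trans (n≤1+n _) h

  up-closed : ∀ ν a b → (suc (suc a) , b) ∈ᵈ ν → (suc a , b) ∈ᵈ ν
  up-closed ν a _ (h , k) = h , ≤-trans k (antitone-part ν a)

  removable⇒corner : ∀ μ p → Removable μ p → RemovableCorner μ p
  removable⇒corner μ (zero  , suc b) ((_ , ()) , _)
  removable⇒corner μ (suc a , suc b) ((_ , b≤) , ν , eqv) =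
    s≤s z≤n , ≤-antisym b≤ (≮⇒≥ notleft) , ≰⇒> notbelow
    where
    open Equivalence
    notin : ¬ ((suc a , suc b) ∈ᵈ ν)
    notin h = proj₂ (to (eqv (suc a , suc b)) h) refl
    notleft : ¬ (suc b < part μ (suc a))
    notleft h = notin (left-closed ν (suc a) b (from (eqv (suc a , suc (suc b))) ((s≤s z≤n , h) , λ ())))
    notbelow : ¬ (suc b ≤ part μ (suc (suc a)))
    notbelow h = notin (up-closed ν a (suc b) (from (eqv (suc (suc a) , suc b)) ((s≤s z≤n , h) , λ ())))

  addable⇒corner : ∀ μ p → Addable μ p → AddableCorner μ p
  addable⇒corner μ (a , b) (p∉μ , ν , eqv) with Equivalence.from (eqv (a , b)) (inj₂ refl)
  addable⇒corner μ (zero  , suc b) (p∉μ , ν , eqv) | _ , ()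
  addable⇒corner μ (suc a , suc b) (p∉μ , ν , eqv) | p∈ν =
    s≤s z≤n , cong suc (≤-antisym (left (suc a) b p∈ν eqv) (≤-pred (≰⇒> λ h → p∉μ (s≤s z≤n , h)))) , above a eqv p∈ν
    where
    open Equivalence
    left : ∀ a b → (a , suc b) ∈ᵈ ν →
           (∀ q → q ∈ᵈ ν ⇔ (q ∈ᵈ μ ⊎ q ≡ (a , suc b))) → b ≤ part μ a
    left a zero    _ _ = z≤n
    left a (suc b) h e with to (e (a , suc b)) (left-closed ν a b h)
    ... | inj₁ (_ , k) = k
    above : ∀ a → (∀ q → q ∈ᵈ ν ⇔ (q ∈ᵈ μ ⊎ q ≡ (suc a , suc b))) → (suc a , suc b) ∈ᵈ ν →
            suc a ≡ 1 ⊎ suc b ≤ part μ a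
    above zero    _ _ = inj₁ refl
    above (suc a) e h with to (e (suc a , suc b)) (up-closed ν a (suc b) h)
    ... | inj₁ (_ , k) = inj₂ k

  update : (ℕ → ℕ) → ℕ → ℕ → ℕ → ℕ
  update g a v c with c ≟ a
  ... | yes _ = v
  ... | no  _ = g c

  update-same : ∀ g a v → update g a v a ≡ v
  update-same g a v with a ≟ a
  ... | yes _  = refl
  ... | no a≢a = ⊥-elim (a≢a refl)

  update-other : ∀ g a v {c} → c ≢ a → update g a v c ≡ g c
  update-other g a v {c} c≢a with c ≟ a
  ... | yes c≡a = ⊥-elim (c≢a c≡a)
  ... | no  _   = refl

  update-antitone : ∀ g a v → Antitone g → g (suc a) ≤ v → (∀ c → suc c ≡ a → v ≤ g c) →
                    Antitone (update g a v)
  update-antitone g a v anti below above c with suc c ≟ a | c ≟ a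
  ... | yes e | yes e′ = ≤-refl
  ... | yes e | no _   = above c e
  ... | no _  | yes e′ = subst (λ z → g (suc z) ≤ v) (sym e′) below
  ... | no _  | no _   = anti c

  updated : ∀ μ a v → part μ (suc (suc a)) ≤ v → (∀ c → suc c ≡ a → v ≤ part μ (suc c)) →
            Σ Partition λ ν → ∀ c → part ν (suc c) ≡ update (λ d → part μ (suc d)) a v c
  updated μ a v below above =
    fromFun (update row a v) (update-antitone row a v (antitone-part μ) below above)
            (length (parts μ) + suc a)
            (trans (update-other row a v (>⇒≢ (m≤n+m (suc a) (length (parts μ)))))
                   (nth-beyond (parts μ) _ (m≤m+n _ _)))
    where
    row : ℕ → ℕ
    row d = part μ (suc d)

  corner⇒removable : ∀ μ p → RemovableCorner μ p → Removable μ p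
  corner⇒removable μ (zero , b) (1≤b , refl , _) = ⊥-elim (1+n≰n 1≤b)
  corner⇒removable μ (suc a , suc b) (1≤b , b≡ , below)
    with updated μ a b (≤-pred below)
                 (λ { c refl → ≤-trans (≤-trans (n≤1+n b) (≤-reflexive b≡)) (antitone-part μ c) })
  ... | ν , rows = (1≤b , ≤-reflexive b≡) , ν , λ q → mk⇔ (to q) (from q)
    where
    to : ∀ q → q ∈ᵈ ν → q ∈ᵈ μ × q ≢ (suc a , suc b)
    to (zero  , _) (h , k) = ⊥-elim (1+n≰n (≤-trans h k))
    to (suc c , d) (h , k) with c ≟ a
    ... | yes refl = (h , ≤-trans d≤b (≤-trans (n≤1+n b) (≤-reflexive b≡))) , λ { refl → 1+n≰n d≤b }
      where
      d≤b : d ≤ b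
      d≤b = ≤-trans k (≤-reflexive (trans (rows a) (update-same _ a b)))
    ... | no c≢a = (h , ≤-trans k (≤-reflexive (trans (rows c) (update-other _ a b c≢a)))) , λ { refl → c≢a refl }
    from : ∀ q → q ∈ᵈ μ × q ≢ (suc a , suc b) → q ∈ᵈ ν
    from (zero  , _) ((h , k) , _) = ⊥-elim (1+n≰n (≤-trans h k))
    from (suc c , d) ((h , k) , q≢) with c ≟ a
    ... | yes refl = h , ≤-trans (≤-pred (≤∧≢⇒< (≤-trans k (≤-reflexive (sym b≡))) λ { refl → q≢ refl }))
                                 (≤-reflexive (sym (trans (rows a) (update-same _ a b))))
    ... | no c≢a = h , ≤-trans k (≤-reflexive (sym (trans (rows c) (update-other _ a b c≢a))))

  corner⇒addable : ∀ μ p → AddableCorner μ p → Addable μ p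
  corner⇒addable μ (suc a , _) (_ , refl , above)
    with updated μ a (suc (part μ (suc a))) (≤-trans (antitone-part μ a) (n≤1+n _)) (above′ above)
    where
    above′ : ∀ {a b} → suc a ≡ 1 ⊎ b ≤ part μ a → ∀ c → suc c ≡ a → b ≤ part μ (suc c)
    above′ (inj₁ ()) c refl
    above′ (inj₂ h)  c refl = h
  ... | ν , rows = (λ { (_ , h) → 1+n≰n h }) , ν , λ q → mk⇔ (to q) (from q)
    where
    b = suc (part μ (suc a))
    to : ∀ q → q ∈ᵈ ν → q ∈ᵈ μ ⊎ q ≡ (suc a , b)
    to (zero  , _) (h , k) = ⊥-elim (1+n≰n (≤-trans h k))
    to (suc c , d) (h , k) with c ≟ a
    ... | no c≢a = inj₁ (h , ≤-trans k (≤-reflexive (trans (rows c) (update-other _ a b c≢a))))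
    ... | yes refl with m≤n⇒m<n∨m≡n (≤-trans k (≤-reflexive (trans (rows a) (update-same _ a b))))
    ...   | inj₁ d<b = inj₁ (h , ≤-pred d<b)
    ...   | inj₂ d≡b = inj₂ (cong (suc a ,_) d≡b)
    from : ∀ q → q ∈ᵈ μ ⊎ q ≡ (suc a , b) → q ∈ᵈ ν
    from q (inj₂ refl) = s≤s z≤n , ≤-reflexive (sym (trans (rows a) (update-same _ a b)))
    from (zero  , _) (inj₁ (h , k)) = ⊥-elim (1+n≰n (≤-trans h k))
    from (suc c , d) (inj₁ (h , k)) with c ≟ a
    ... | no c≢a = h , ≤-trans k (≤-reflexive (sym (trans (rows c) (update-other _ a b c≢a))))
    ... | yes refl = h , ≤-trans (≤-trans k (n≤1+n _)) (≤-reflexive (sym (trans (rows a) (update-same _ a b))))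

removable⇔corner : ∀ μ p → Removable μ p ⇔ RemovableCorner μ p
removable⇔corner μ p = mk⇔ (removable⇒corner μ p) (corner⇒removable μ p)

addable⇔corner : ∀ μ p → Addable μ p ⇔ AddableCorner μ p
addable⇔corner μ p = mk⇔ (addable⇒corner μ p) (corner⇒addable μ p)

removable? : ∀ μ p → Dec (Removable μ p)
removable? μ p@(a , b) = map′ (corner⇒removable μ p) (removable⇒corner μ p)
  (1 ≤? b ×-dec b ≟ part μ a ×-dec part μ (suc a) <? b)

addable? : ∀ μ p → Dec (Addable μ p)
addable? μ p@(a , b) = map′ (corner⇒addable μ p) (addable⇒corner μ p)
  (1 ≤? a ×-dec b ≟ suc (part μ a) ×-dec (a ≟ 1 ⊎-dec b ≤? part μ (pred a)))

residue : (ℓ : ℕ) .{{_ : NonZero ℓ}} → Position → ℕ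
residue ℓ (a , b) = (b ⊖ a) %ℕ ℓ

SignedPosition : Set
SignedPosition = Position × Sign

IBox : (ℓ : ℕ) .{{_ : NonZero ℓ}} → ℕ → Partition → SignedPosition → Set
IBox ℓ i μ (p , Sign.+) = Addable μ p × residue ℓ p ≡ i
IBox ℓ i μ (p , Sign.-) = Removable μ p × residue ℓ p ≡ i

iBox? : (ℓ : ℕ) .{{_ : NonZero ℓ}} → ∀ i μ x → Dec (IBox ℓ i μ x)
iBox? ℓ i μ (p , Sign.+) = addable? μ p ×-dec residue ℓ p ≟ i
iBox? ℓ i μ (p , Sign.-) = removable? μ p ×-dec residue ℓ p ≟ i

windowRows windowColumns : Partition → List ℕ
windowRows    μ = map suc (downFrom (suc (length (parts μ))))
windowColumns μ = map suc (upTo (suc (part μ 1)))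

-- A window, listed from the bottom row to the top row, that contains every
-- addable and every removable box (see ∈-iBoxes).
window : Partition → List SignedPosition
window μ = cartesianProduct (cartesianProduct (windowRows μ) (windowColumns μ)) (Sign.- ∷ Sign.+ ∷ [])

-- All addable and removable i-boxes, from the bottom row to the top row.  For
-- ℓ ≥ 2 no row contains two of them, so this determines the order.
iBoxes : (ℓ : ℕ) .{{_ : NonZero ℓ}} → ℕ → Partition → List SignedPosition
iBoxes ℓ i μ = filter (iBox? ℓ i μ) (window μ)

private

  removable∈window : ∀ μ p → RemovableCorner μ p → (p , Sign.-) ∈ window μ
  removable∈window μ (zero  , b)     (1≤b , refl , _) = ⊥-elim (1+n≰n 1≤b)
  removable∈window μ (suc a , suc b) (_ , b≡ , _) = ∈-cartesianProduct⁺
    (∈-cartesianProduct⁺ (∈-map⁺ suc (∈-downFrom⁺ (≤-trans a<len (n≤1+n _))))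
      (∈-map⁺ suc (∈-upTo⁺ (≤-trans (≤-reflexive b≡) (≤-trans (nth-head (decreasing μ) (suc a)) (n≤1+n _))))))
    (here refl)
    where
    a<len : a < length (parts μ)
    a<len = ≰⇒> λ h → 1+n≢0 (trans b≡ (nth-beyond (parts μ) a h))

  addable∈window : ∀ μ p → AddableCorner μ p → (p , Sign.+) ∈ window μ
  addable∈window μ (suc a , _) (_ , refl , above) = ∈-cartesianProduct⁺
    (∈-cartesianProduct⁺ (∈-map⁺ suc (∈-downFrom⁺ (s≤s (a≤len a above))))
      (∈-map⁺ suc (∈-upTo⁺ (s≤s (nth-head (decreasing μ) (suc a))))))
    (there (here refl))
    where
    a≤len : ∀ a {b} → suc a ≡ 1 ⊎ suc b ≤ part μ a → a ≤ length (parts μ)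
    a≤len zero    _        = z≤n
    a≤len (suc a) (inj₂ h) = ≰⇒> λ k → 1+n≰n (≤-trans (s≤s z≤n) (≤-trans h (≤-reflexive (nth-beyond (parts μ) a k))))

∈-iBoxes : (ℓ : ℕ) .{{_ : NonZero ℓ}} → ∀ i μ x → IBox ℓ i μ x → x ∈ iBoxes ℓ i μ
∈-iBoxes ℓ i μ x h = ∈-filter⁺ (iBox? ℓ i μ) (in-window x h) h
  where
  in-window : ∀ x → IBox ℓ i μ x → x ∈ window μ
  in-window (p , Sign.+) (h , _) = addable∈window μ p (addable⇒corner μ p h)
  in-window (p , Sign.-) (h , _) = removable∈window μ p (removable⇒corner μ p h)

iSignature : (ℓ : ℕ) .{{_ : NonZero ℓ}} → ℕ → Partition → List Sign
iSignature ℓ i μ = map proj₂ (iBoxes ℓ i μ)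

-- OnLadder ℓ (a , b) (c , d): the position (c , d) is on the ladder of (a , b).
OnLadder : ℕ → Position → Position → Set
OnLadder ℓ (a , b) (c , d) =
  1 ≤ c × 1 ≤ d × (ℤ.+ c ℤ.- ℤ.+ a ≡ (ℤ.+ ℓ ℤ.- 1ℤ) ℤ.* (ℤ.+ b ℤ.- ℤ.+ d))

onLadder? : ∀ ℓ p q → Dec (OnLadder ℓ p q)
onLadder? ℓ (a , b) (c , d) = 1 ≤? c ×-dec 1 ≤? d ×-dec
  (ℤ.+ c ℤ.- ℤ.+ a) ℤ.≟ ((ℤ.+ ℓ ℤ.- 1ℤ) ℤ.* (ℤ.+ b ℤ.- ℤ.+ d))

-- Ladders are ordered by this number, which is constant on each of them.
ladderNumber : ℕ → Position → ℕ
ladderNumber ℓ (a , b) = a + (ℓ ∸ 1) * (b ∸ 1)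

ladderNumbers : ℕ → Partition → List ℕ
ladderNumbers ℓ μ = map suc (upTo (ladderNumber ℓ (suc (length (parts μ)) , suc (part μ 1))))

-- The ladder with number n is the ladder of (n , 1) (see onFirstColumnLadder),
-- so going through the ladders from left to right means going through the
-- ladders of (1 , 1), (2 , 1), (3 , 1), …; those in ladderNumbers contain the
-- whole window (see ∈-ladderBoxes).  iBoxes already runs from bottom to top, so
-- each ladder is read from bottom to top.
ladderBoxes : (ℓ : ℕ) .{{_ : NonZero ℓ}} → ℕ → Partition → List SignedPosition
ladderBoxes ℓ i μ = concatMap (λ n → filter (λ x → onLadder? ℓ (n , 1) (proj₁ x)) (iBoxes ℓ i μ)) (ladderNumbers ℓ μ)

onFirstColumnLadder : (ℓ : ℕ) .{{_ : NonZero ℓ}} → ∀ n c d → 1 ≤ c → 1 ≤ d →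
                      OnLadder ℓ (n , 1) (c , d) ⇔ n ≡ ladderNumber ℓ (c , d)
onFirstColumnLadder (suc l) n (suc c) (suc d) 1≤c 1≤d = mk⇔
  (λ { (_ , _ , h) → ℤₚ.+-injective (trans (to (ℤ.+ suc c) (ℤ.+ n) (ℤ.+ l) (ℤ.+ d) h) (sym number)) })
  (λ h → 1≤c , 1≤d , trans (cong (ℤ._-_ (ℤ.+ suc c)) (trans (cong ℤ.+_ h) number))
                           (from (ℤ.+ suc c) (ℤ.+ l) (ℤ.+ d)))
  where
  number : ℤ.+ (suc c + l * d) ≡ ℤ.+ suc c ℤ.+ ℤ.+ l ℤ.* ℤ.+ d
  number = trans (ℤₚ.pos-+ (suc c) (l * d)) (cong (ℤ._+_ (ℤ.+ suc c)) (ℤₚ.pos-* l d))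
  from : ∀ x y z → x ℤ.- (x ℤ.+ y ℤ.* z) ≡ y ℤ.* (1ℤ ℤ.- (1ℤ ℤ.+ z))
  from = solve-∀
  rearrange₁ : ∀ x m → m ≡ x ℤ.- (x ℤ.- m)
  rearrange₁ = solve-∀
  rearrange₂ : ∀ x y z → x ℤ.- y ℤ.* (1ℤ ℤ.- (1ℤ ℤ.+ z)) ≡ x ℤ.+ y ℤ.* z
  rearrange₂ = solve-∀
  to : ∀ x m y z → x ℤ.- m ≡ y ℤ.* (1ℤ ℤ.- (1ℤ ℤ.+ z)) → m ≡ x ℤ.+ y ℤ.* z
  to x m y z h = trans (rearrange₁ x m) (trans (cong (ℤ._-_ x) h) (rearrange₂ x y z))

∈-ladderBoxes : (ℓ : ℕ) .{{_ : NonZero ℓ}} → ∀ i μ x → IBox ℓ i μ x → x ∈ ladderBoxes ℓ i μ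
∈-ladderBoxes ℓ i μ x h
  with ∈-cartesianProduct⁻ (cartesianProduct (windowRows μ) (windowColumns μ)) (Sign.- ∷ Sign.+ ∷ [])
         (proj₁ (∈-filter⁻ (iBox? ℓ i μ) {xs = window μ} (∈-iBoxes ℓ i μ x h)))
... | x∈ , _ with ∈-cartesianProduct⁻ (windowRows μ) (windowColumns μ) x∈
...   | row∈ , col∈ with ∈-map⁻ suc row∈ | ∈-map⁻ suc col∈
∈-ladderBoxes ℓ i μ x@((_ , _) , s) h | _ | _ | a , a∈ , refl | b , b∈ , refl =
  ∈-concatMap⁺ (λ n → filter (λ y → onLadder? ℓ (n , 1) (proj₁ y)) (iBoxes ℓ i μ)) (Any.map (λ { refl → ∈-filter⁺ (λ y → onLadder? ℓ (number , 1) (proj₁ y))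
                                         (∈-iBoxes ℓ i μ x h) on }) number∈)
  where
  number : ℕ
  number = ladderNumber ℓ (suc a , suc b)
  on : OnLadder ℓ (number , 1) (suc a , suc b)
  on = Equivalence.from (onFirstColumnLadder ℓ number (suc a) (suc b) (s≤s z≤n) (s≤s z≤n)) refl
  number∈ : number ∈ ladderNumbers ℓ μ
  number∈ = ∈-map⁺ suc (∈-upTo⁺ (+-mono-≤ {suc a} {suc (length (parts μ))} (∈-downFrom⁻ a∈) (*-monoʳ-≤ (ℓ ∸ 1) (≤-pred (∈-upTo⁻ b∈)))))

ladderWord : (ℓ : ℕ) .{{_ : NonZero ℓ}} → ℕ → Partition → List Sign
ladderWord ℓ i μ = map proj₂ (ladderBoxes ℓ i μ)

infix 4 _⟶_

data _⟶_ : List Sign → List Sign → Set where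
  cancel : ∀ u v → u ++ Sign.- ∷ Sign.+ ∷ v ⟶ u ++ v

-- ReducesTo w r: r is what is left of w when no further deletion is possible.
ReducesTo : List Sign → List Sign → Set
ReducesTo w r = Star _⟶_ w r × (∀ s → ¬ (r ⟶ s))

{-# OPTIONS --safe #-}

-- Let the boxes (c , d) and (a , b) be addable or removable, with c > a.  The
-- rows a + 1, …, c - 1 have lengths in [d , b - 1], and by regularity at most
-- ℓ - 1 of them share a length, so c - a - 1 ≤ (ℓ - 1)(b - d).  If equality
-- held, the contents of the two boxes would differ by ℓ(b - d) + 1, which is
-- impossible when their residues agree.  Hence c - a ≤ (ℓ - 1)(b - d): the lower
-- box lies on the same ladder as the upper one or further left, so reading along
-- ladders does not change the bottom-to-top order.
module Submission where

open import Defs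
open import Data.Empty using (⊥-elim)
open import Data.Integer as ℤ using (ℤ; _⊖_; _%ℕ_; _/ℕ_)
open import Data.Integer.DivMod using (a≡a%ℕn+[a/ℕn]*n)
import Data.Integer.Properties as ℤₚ
open import Data.Integer.Tactic.RingSolver using (solve-∀)
open import Data.List.Base using ([]; _∷_; map; filter; length; concatMap; cartesianProduct; _++_)
open import Data.List.Membership.Propositional using (_∈_)
open import Data.List.Membership.Propositional.Properties using (∈-concatMap⁻; ∈-filter⁻)
open import Data.List.Properties using (filter-accept; filter-reject; filter-none)
open import Data.List.Relation.Unary.All as All using (All; []; _∷_)
import Data.List.Relation.Unary.All.Properties as Allₚ
open import Data.List.Relation.Unary.AllPairs as AllPairs using (AllPairs; []; _∷_)
import Data.List.Relation.Unary.AllPairs.Properties as AllPairsₚ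
open import Data.List.Relation.Unary.Any as Any using (here; there)
open import Data.List.Relation.Unary.Linked as Linked using (Linked; []; [-]; _∷_)
open import Data.Nat.Base
open import Data.Nat.Properties
open import Data.Product.Base using (∃; _×_; _,_; proj₁; proj₂)
open import Data.Sign.Base using (Sign)
open import Data.Sum.Base using (_⊎_; inj₁; inj₂)
open import Data.Unit.Base using (⊤; tt)
open import Function.Base using (id; _∘_)
open import Function.Bundles using (_⇔_; Equivalence)
open import Function.Construct.Identity using (⇔-id)
open import Relation.Binary.PropositionalEquality
  using (_≡_; _≢_; refl; sym; trans; cong; cong₂; subst; module ≡-Reasoning)
open import Relation.Nullary using (¬_; yes; no)
open import Relation.Unary using (Decidable)

-- Sorted lists: products, and splitting by keys.

module _ {A B : Set} {R : A → A → Set} {S : B → B → Set} where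

  Lexicographic : A × B → A × B → Set
  Lexicographic (x , y) (x′ , y′) = R x x′ ⊎ (x ≡ x′ × S y y′)

  cartesianProduct-allPairs : ∀ {xs ys} → AllPairs R xs → AllPairs S ys →
                              AllPairs Lexicographic (cartesianProduct xs ys)
  cartesianProduct-allPairs []         _  = []
  cartesianProduct-allPairs {ys = ys} (_∷_ {x} {xs} rx rs) ss = AllPairsₚ.++⁺
    (AllPairsₚ.map⁺ (AllPairs.map (λ s → inj₂ (refl , s)) ss))
    (cartesianProduct-allPairs rs ss)
    (Allₚ.map⁺ (All.universal (λ _ → later rx) ys))
    where
    later : ∀ {y zs} → All (R x) zs → All (Lexicographic (x , y)) (cartesianProduct zs ys)
    later []       = []
    later (r ∷ rs) = Allₚ.++⁺ (Allₚ.map⁺ (All.universal (λ _ → inj₁ r) ys)) (later rs)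

-- Row order will control ladder numbers by way of the corner conditions and the common residue,
-- both of which `P` supplies when it is taken to be `IBox`.
allPairs-map-with : {A : Set} {P : A → Set} {R S : A → A → Set} →
                    (∀ {x y} → P x → P y → R x y → S x y) →
                    ∀ {xs} → All P xs → AllPairs R xs → AllPairs S xs
allPairs-map-with f []       []       = []
allPairs-map-with f (p ∷ ps) (r ∷ rs) =
  All.zipWith (λ (q , r) → f p q r) (ps , r) ∷ allPairs-map-with f ps rs

module _ {A : Set} {P : ℕ → A → Set} (P? : ∀ n → Decidable (P n)) where

  concatMap-filter-reject : ∀ {x xs ns} → All (λ n → ¬ P n x) ns →
    concatMap (λ n → filter (P? n) (x ∷ xs)) ns ≡ concatMap (λ n → filter (P? n) xs) ns
  concatMap-filter-reject []       = refl
  concatMap-filter-reject (¬p ∷ ps) =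
    cong₂ _++_ (filter-reject (P? _) ¬p) (concatMap-filter-reject ps)

  -- Induction on both lists. If the key of the head is the first number, the head opens the first
  -- block and occurs in no later one. Otherwise all keys exceed the first number, so its block is
  -- empty. Entries with equal keys keep their order because `filter` does.
  concatMap-filter-sorted : (f : A → ℕ) → ∀ {xs ns} →
    All (λ x → ∀ n → P n x ⇔ n ≡ f x) xs → All (λ x → f x ∈ ns) xs →
    AllPairs (λ x y → f x ≤ f y) xs → AllPairs _<_ ns →
    concatMap (λ n → filter (P? n) xs) ns ≡ xs
  concatMap-filter-sorted f {[]} [] [] [] ns = empty ns
    where
    empty : ∀ {ms} → AllPairs _<_ ms → concatMap (λ n → filter (P? n) []) ms ≡ []
    empty []       = refl
    empty (_ ∷ ms) = empty ms
  concatMap-filter-sorted f {x ∷ xs} {n ∷ ns} (e ∷ es) (here refl ∷ ks) (le ∷ les) (lt ∷ lts) = begin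
    filter (P? n) (x ∷ xs) ++ concatMap (λ m → filter (P? m) (x ∷ xs)) ns
      ≡⟨ cong₂ _++_ (filter-accept (P? n) (Equivalence.from (e n) refl))
               (concatMap-filter-reject (All.map (λ n<m p → <⇒≢ n<m (sym (Equivalence.to (e _) p))) lt)) ⟩
    -- `n` stays in the list, since entries of `xs` may share the key of `x`.
    x ∷ concatMap (λ m → filter (P? m) xs) (n ∷ ns)
      ≡⟨ cong (x ∷_) (concatMap-filter-sorted f es ks les (lt ∷ lts)) ⟩
    x ∷ xs ∎
    where open ≡-Reasoning
  concatMap-filter-sorted f {x ∷ xs} {n ∷ ns} es@(_ ∷ _) (there k ∷ ks) les@(le ∷ _) (lt ∷ lts) = begin
    filter (P? n) (x ∷ xs) ++ concatMap (λ m → filter (P? m) (x ∷ xs)) ns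
      ≡⟨ cong (_++ _) (filter-none (P? n)
           (All.zipWith (λ (e , n<f) p → <⇒≢ n<f (Equivalence.to (e n) p)) (es , n<))) ⟩
    concatMap (λ m → filter (P? m) (x ∷ xs)) ns
      ≡⟨ concatMap-filter-sorted f es (All.zipWith tail-key (n< , (there k ∷ ks))) les lts ⟩
    x ∷ xs ∎
    where
    open ≡-Reasoning
    n<fx : n < f x
    n<fx = All.lookup lt k
    n< : All (λ y → n < f y) (x ∷ xs)
    n< = n<fx ∷ All.map (<-≤-trans n<fx) le
    tail-key : ∀ {y} → n < f y × f y ∈ n ∷ ns → f y ∈ ns
    tail-key (n<fy , here eq) = ⊥-elim (<⇒≢ n<fy (sym eq))
    tail-key (_    , there k) = k

-- Row lengths of regular partitions.

nth-antitone : ∀ {xs} → Linked _≥_ xs → ∀ {a b} → a ≤ b → nth xs (suc b) ≤ nth xs (suc a)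
nth-antitone []       _                 = z≤n
nth-antitone [-]      {b = zero}  z≤n   = ≤-refl
nth-antitone [-]      {b = suc _} _     = z≤n
nth-antitone (_ ∷ _)  {b = zero}  z≤n   = ≤-refl
nth-antitone (r ∷ rs) {b = suc b} z≤n   = ≤-trans (nth-antitone rs {0} {b} z≤n) r
nth-antitone (_ ∷ rs) (s≤s a≤b)         = nth-antitone rs a≤b

length-filter-∷ : ∀ k x xs → length (filter (k ≟_) xs) ≤ length (filter (k ≟_) (x ∷ xs))
length-filter-∷ k x xs with k ≟ x
... | yes k≡x = ≤-trans (n≤1+n _) (≤-reflexive (cong length (sym (filter-accept (k ≟_) k≡x))))
... | no  k≢x = ≤-reflexive (cong length (sym (filter-reject (k ≟_) k≢x)))

-- By monotonicity the entries from `suc a` to `suc (a + m)` are squeezed to the value `k`. Heads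
-- are dropped until the run starts the list; then it is counted off.
constant-run : ∀ {xs} → Linked _≥_ xs → ∀ {k} → 1 ≤ k → ∀ a m →
               nth xs (suc a) ≤ k → k ≤ nth xs (suc (a + m)) → suc m ≤ length (filter (k ≟_) xs)
-- As `k` is positive, the run cannot reach the default zeros past the end.
constant-run {[]} _ 1≤k a m _ hi = ⊥-elim (1+n≰n (≤-trans 1≤k hi))
constant-run {x ∷ xs} l {k} 1≤k (suc a) m lo hi =
  ≤-trans (constant-run (Linked.tail l) 1≤k a m lo hi) (length-filter-∷ k x xs)
constant-run {x ∷ xs} l {k} 1≤k zero m lo hi =
  ≤-trans (s≤s (rest m hi)) (≤-reflexive (cong length (sym (filter-accept (k ≟_) k≡x))))
  where
  k≡x : k ≡ x
  k≡x = ≤-antisym (≤-trans hi (nth-antitone l {0} {m} z≤n)) lo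
  rest : ∀ m → k ≤ nth (x ∷ xs) (suc m) → m ≤ length (filter (k ≟_) xs)
  rest zero    _  = z≤n
  rest (suc m) hi = constant-run (Linked.tail l) 1≤k 0 m (≤-trans (nth-antitone l {0} {1} z≤n) lo) hi

-- Without a drop, the `suc l` rows from `suc a` to `suc (a + l)` would have one common nonzero
-- length, which regularity forbids.
regular-drop : ∀ {l μ} → Regular (suc l) μ → ∀ a → 1 ≤ part μ (suc (a + l)) →
               part μ (suc (a + l)) < part μ (suc a)
regular-drop {l} {μ} reg a 1≤k = ≰⇒> λ le →
  <⇒≱ (reg _ 1≤k) (constant-run (decreasing μ) 1≤k a l le ≤-refl)

regular-drops : ∀ {l μ} → Regular (suc l) μ → ∀ D a → 1 ≤ part μ (suc (a + l * D)) →
                part μ (suc (a + l * D)) + D ≤ part μ (suc a)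
regular-drops {l} {μ} reg zero    a _ rewrite *-zeroʳ l | +-identityʳ a =
  ≤-reflexive (+-identityʳ _)
regular-drops {l} {μ} reg (suc D) a h
  -- The uppermost block of `l` rows is split off, and the induction treats the `D` blocks below it.
  rewrite *-suc l D | sym (+-assoc a l (l * D)) = begin
  part μ (suc (a + l + l * D)) + suc D   ≡⟨ +-suc _ D ⟩
  suc (part μ (suc (a + l + l * D)) + D) ≤⟨ s≤s (regular-drops {μ = μ} reg D (a + l) h) ⟩
  suc (part μ (suc (a + l)))             ≤⟨ regular-drop {μ = μ} reg a
                                             (≤-trans h (nth-antitone (decreasing μ) (m≤m+n (a + l) (l * D)))) ⟩
  part μ (suc a)                         ∎
  where open ≤-Reasoning

-- Corners and the ladders of two boxes of equal residue.

-- Necessary conditions shared by addable and removable boxes (a , b).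
record Corner (μ : Partition) (a b : ℕ) : Set where
  constructor corner
  field
    1≤a   : 1 ≤ a
    1≤b   : 1 ≤ b
    row   : part μ a ≤ b
    below : part μ (suc a) < b
    above : a ≡ 1 ⊎ b ≤ part μ (pred a)

iBox⇒corner : ∀ ℓ .{{_ : NonZero ℓ}} i μ {a b s} → IBox ℓ i μ ((a , b) , s) → Corner μ a b
iBox⇒corner ℓ i μ {a} {b} {Sign.+} (add , _) with Equivalence.to (addable⇔corner μ (a , b)) add
iBox⇒corner ℓ i μ {suc a} {_} {Sign.+} _ | 1≤a , refl , above =
  corner 1≤a (s≤s z≤n) (n≤1+n _)
         (s≤s (nth-antitone (decreasing μ) (n≤1+n a)))
         above
iBox⇒corner ℓ i μ {a} {b} {Sign.-} (rem , _) with Equivalence.to (removable⇔corner μ (a , b)) rem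
iBox⇒corner ℓ i μ {zero}        {_} {Sign.-} _ | 1≤b , refl , _ = ⊥-elim (1+n≰n 1≤b)
iBox⇒corner ℓ i μ {suc zero}    {_} {Sign.-} _ | 1≤b , refl , below =
  corner (s≤s z≤n) 1≤b ≤-refl below (inj₁ refl)
iBox⇒corner ℓ i μ {suc (suc a)} {_} {Sign.-} _ | 1≤b , refl , below =
  corner (s≤s z≤n) 1≤b ≤-refl below
         (inj₂ (nth-antitone (decreasing μ) (n≤1+n a)))

iBox⇒residue : ∀ ℓ .{{_ : NonZero ℓ}} i μ p {s} → IBox ℓ i μ (p , s) → residue ℓ p ≡ i
iBox⇒residue ℓ i μ p {Sign.+} (_ , r) = r
iBox⇒residue ℓ i μ p {Sign.-} (_ , r) = r

-- The contents differ by `suc l * D + 1`, so equal residues would make `suc l` divide 1.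
residue-shift : ∀ l a b D → 1 ≤ l → residue (suc l) (suc (a + l * D) , b) ≢ residue (suc l) (a , b + D)
residue-shift l a b D 1≤l eq = 1+n≰n (≤-trans 1≤l (≤-pred (≤-reflexive ℓ≡1)))
  where
  open ≡-Reasoning
  -- `u` and `v` are the contents of the lower and the upper box, `q` and `q′` their quotients by
  -- `suc l`.
  u v q q′ : ℤ
  u = b ⊖ suc (a + l * D)
  v = (b + D) ⊖ a
  q = u /ℕ suc l
  q′ = v /ℕ suc l
  u≡ : u ≡ ℤ.+ b ℤ.- (ℤ.1ℤ ℤ.+ (ℤ.+ a ℤ.+ ℤ.+ l ℤ.* ℤ.+ D))
  u≡ = trans (sym (ℤₚ.m-n≡m⊖n b (suc (a + l * D))))
             (cong (λ z → ℤ.+ b ℤ.- (ℤ.1ℤ ℤ.+ z)) (cong (ℤ._+_ (ℤ.+ a)) (ℤₚ.pos-* l D)))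
  v≡ : v ≡ (ℤ.+ b ℤ.+ ℤ.+ D) ℤ.- ℤ.+ a
  v≡ = sym (ℤₚ.m-n≡m⊖n (b + D) a)
  rearrange₁ : ∀ a b l D → ℤ.1ℤ ≡ ((b ℤ.+ D) ℤ.- a) ℤ.- (b ℤ.- (ℤ.1ℤ ℤ.+ (a ℤ.+ l ℤ.* D)))
                                   ℤ.- D ℤ.* (ℤ.1ℤ ℤ.+ l)
  rearrange₁ = solve-∀
  -- The common remainder `r` cancels, which leaves a multiple of the modulus `m`.
  rearrange₂ : ∀ r q q′ D m → (r ℤ.+ q′ ℤ.* m) ℤ.- (r ℤ.+ q ℤ.* m) ℤ.- D ℤ.* m ≡ (q′ ℤ.- q ℤ.- D) ℤ.* m
  rearrange₂ = solve-∀
  1≡ : ℤ.1ℤ ≡ (q′ ℤ.- q ℤ.- ℤ.+ D) ℤ.* ℤ.+ suc l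
  1≡ = begin
    ℤ.1ℤ
      ≡⟨ rearrange₁ (ℤ.+ a) (ℤ.+ b) (ℤ.+ l) (ℤ.+ D) ⟩
    _ ≡⟨ cong₂ (λ x y → x ℤ.- y ℤ.- ℤ.+ D ℤ.* ℤ.+ suc l) (sym v≡) (sym u≡) ⟩
    v ℤ.- u ℤ.- ℤ.+ D ℤ.* ℤ.+ suc l
      ≡⟨ cong₂ (λ x y → x ℤ.- y ℤ.- ℤ.+ D ℤ.* ℤ.+ suc l)
               (trans (a≡a%ℕn+[a/ℕn]*n v (suc l)) (cong (λ r → ℤ.+ r ℤ.+ q′ ℤ.* ℤ.+ suc l) (sym eq)))
               (a≡a%ℕn+[a/ℕn]*n u (suc l)) ⟩
    _ ≡⟨ rearrange₂ (ℤ.+ (u %ℕ suc l)) q q′ (ℤ.+ D) (ℤ.+ suc l) ⟩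
    (q′ ℤ.- q ℤ.- ℤ.+ D) ℤ.* ℤ.+ suc l ∎
  ℓ≡1 : suc l ≡ 1
  ℓ≡1 = m*n≡1⇒n≡1 ℤ.∣ q′ ℤ.- q ℤ.- ℤ.+ D ∣ (suc l)
          (trans (sym (ℤₚ.abs-* (q′ ℤ.- q ℤ.- ℤ.+ D) (ℤ.+ suc l))) (cong ℤ.∣_∣ (sym 1≡)))

-- If `c` were larger, row `suc (a + l * D)` would still lie above row `c` and have length at least
-- `d`. The `D` drops above it would then give row `suc a` length at least `d + D`, that is `b`,
-- against `below`. The extremal value of `c` is left to `residue-shift`.
corner-rows : ∀ {l μ a b c d} → Regular (suc l) μ → Corner μ a b → Corner μ c d → a < c →
              ∃ λ D → b ≡ d + D × c ≤ suc (a + l * D)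
corner-rows {c = suc zero} reg (corner (s≤s _) _ _ _ _) _ (s≤s ())
corner-rows {l} {μ} {a} {b} {suc (suc c)} {d} reg (corner (s≤s {n = a₀} _) _ row below _)
            (corner _ 1≤d _ _ (inj₂ d≤)) (s≤s (s≤s a₀≤c)) =
  b ∸ d , sym (m+[n∸m]≡n d≤b) , ≮⇒≥ too-far
  where
  d≤b : d ≤ b
  -- The row just above the lower box is the row of the upper box or lies below it.
  d≤b = ≤-trans d≤ (≤-trans (nth-antitone (decreasing μ) a₀≤c) row)
  too-far : ¬ (suc (suc (a₀ + l * (b ∸ d))) < suc (suc c))
  too-far (s≤s (s≤s h)) = <⇒≱ below (begin
    b                                                ≡⟨ m+[n∸m]≡n d≤b ⟨
    d + (b ∸ d)                                      ≤⟨ +-monoˡ-≤ (b ∸ d) d≤end ⟩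
    part μ (suc (suc a₀ + l * (b ∸ d))) + (b ∸ d)    ≤⟨ regular-drops {μ = μ} reg (b ∸ d) (suc a₀)
                                                          (≤-trans 1≤d d≤end) ⟩
    part μ (suc (suc a₀))                            ∎)
    where
    open ≤-Reasoning
    d≤end : d ≤ part μ (suc (suc a₀ + l * (b ∸ d)))
    d≤end = ≤-trans d≤ (nth-antitone (decreasing μ) h)

ladderNumber-mono : ∀ {l μ a b c d} → 1 ≤ l → Regular (suc l) μ → Corner μ a b → Corner μ c d → a < c →
                    residue (suc l) (c , d) ≡ residue (suc l) (a , b) →
                    ladderNumber (suc l) (c , d) ≤ ladderNumber (suc l) (a , b)
ladderNumber-mono {l} {μ} {a} {b} {c} {suc e} 1≤l reg upper lower a<c res
  with corner-rows {μ = μ} reg upper lower a<c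
... | D , refl , c≤ with m≤n⇒m<n∨m≡n c≤
-- The extremal distance, one row past the ladder of the upper box, is excluded by residues.
...   | inj₂ refl    = ⊥-elim (residue-shift l a (suc e) D 1≤l res)
...   | inj₁ (s≤s h) = begin
  c + l * e              ≤⟨ +-monoˡ-≤ (l * e) h ⟩
  (a + l * D) + l * e    ≡⟨ +-assoc a (l * D) (l * e) ⟩
  a + (l * D + l * e)    ≡⟨ cong (a +_) (+-comm (l * D) (l * e)) ⟩
  a + (l * e + l * D)    ≡⟨ cong (a +_) (*-distribˡ-+ l e D) ⟨
  a + l * (e + D)        ∎
  where open ≤-Reasoning
ladderNumber-mono {d = zero} _ _ _ (corner _ () _ _ _) _ _

-- Bottom-to-top order against ladder order.

ReadingOrder : SignedPosition → SignedPosition → Set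
ReadingOrder ((a , b) , _) ((c , d) , _) = c < a ⊎ (a ≡ c × b ≤ d)

window-sorted : ∀ μ → AllPairs ReadingOrder (window μ)
window-sorted μ = AllPairs.map (λ {x} {y} → order x y)
  (cartesianProduct-allPairs {S = λ _ _ → ⊤}
    (cartesianProduct-allPairs
      (AllPairsₚ.map⁺ (AllPairsₚ.applyDownFrom⁺₁ id (suc (length (parts μ))) (λ j<i _ → s≤s j<i)))
      (AllPairsₚ.map⁺ (AllPairsₚ.applyUpTo⁺₁ id (suc (part μ 1)) (λ i<j _ → s≤s i<j))))
    ((tt ∷ []) ∷ [] ∷ []))
  where
  order : ∀ x y → Lexicographic {R = Lexicographic {R = _>_} {S = _<_}} {S = λ _ _ → ⊤} x y →
          ReadingOrder x y
  order _ _ (inj₁ (inj₁ c<a))          = inj₁ c<a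
  order _ _ (inj₁ (inj₂ (refl , b<d))) = inj₂ (refl , <⇒≤ b<d)
  -- `window` lists each position with both signs, hence the weak inequality of columns in
  -- `ReadingOrder`.
  order _ _ (inj₂ (refl , _))          = inj₂ (refl , ≤-refl)

iBoxes-sorted : ∀ l i μ → 1 ≤ l → Regular (suc l) μ →
  AllPairs (λ x y → ladderNumber (suc l) (proj₁ x) ≤ ladderNumber (suc l) (proj₁ y)) (iBoxes (suc l) i μ)
iBoxes-sorted l i μ 1≤l reg = allPairs-map-with (λ {x} {y} → mono x y)
  (Allₚ.all-filter (iBox? (suc l) i μ) (window μ))
  (AllPairsₚ.filter⁺ (iBox? (suc l) i μ) (window-sorted μ))
  where
  mono : ∀ x y → IBox (suc l) i μ x → IBox (suc l) i μ y → ReadingOrder x y →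
         ladderNumber (suc l) (proj₁ x) ≤ ladderNumber (suc l) (proj₁ y)
  -- The box read first is the lower one, so the second takes the role of the upper corner.
  mono (p@(a , b) , s) (q@(c , d) , t) bx by (inj₁ c<a) =
    ladderNumber-mono {μ = μ} 1≤l reg (iBox⇒corner (suc l) i μ {s = t} by) (iBox⇒corner (suc l) i μ {s = s} bx)
      c<a (trans (iBox⇒residue (suc l) i μ p {s} bx) (sym (iBox⇒residue (suc l) i μ q {t} by)))
  mono ((a , _) , _) _ _ _ (inj₂ (refl , b≤d)) = +-monoʳ-≤ a (*-monoʳ-≤ l (∸-monoˡ-≤ 1 b≤d))

-- Ladders split the boxes by the key `ladderNumber`, and the bottom-to-top list is already sorted
-- by this key.
ladderBoxes≡iBoxes : ∀ l i μ → 1 ≤ l → Regular (suc l) μ → ladderBoxes (suc l) i μ ≡ iBoxes (suc l) i μ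
ladderBoxes≡iBoxes l i μ 1≤l reg = concatMap-filter-sorted
  (λ n x → onLadder? (suc l) (n , 1) (proj₁ x))
  (ladderNumber (suc l) ∘ proj₁)
  (All.map (λ {x} → on x) boxes)
  (All.map (λ {x} → listed x) boxes)
  (iBoxes-sorted l i μ 1≤l reg)
  (AllPairsₚ.map⁺ (AllPairsₚ.applyUpTo⁺₁ id
    (ladderNumber (suc l) (suc (length (parts μ)) , suc (part μ 1))) (λ i<j _ → s≤s i<j)))
  where
  boxes : All (IBox (suc l) i μ) (iBoxes (suc l) i μ)
  boxes = Allₚ.all-filter (iBox? (suc l) i μ) (window μ)
  on : ∀ x → IBox (suc l) i μ x → ∀ n → OnLadder (suc l) (n , 1) (proj₁ x) ⇔ n ≡ ladderNumber (suc l) (proj₁ x)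
  on ((a , b) , s) box n = onFirstColumnLadder (suc l) n a b (Corner.1≤a k) (Corner.1≤b k)
    where k = iBox⇒corner (suc l) i μ {s = s} box
  listed : ∀ x → IBox (suc l) i μ x → ladderNumber (suc l) (proj₁ x) ∈ ladderNumbers (suc l) μ
  -- `∈-ladderBoxes` places the box on some listed ladder, whose number must be that of the box.
  listed x box = Any.map
    (λ {n} x∈ → sym (Equivalence.to (on x box n)
      (proj₂ (∈-filter⁻ (λ y → onLadder? (suc l) (n , 1) (proj₁ y)) {xs = iBoxes (suc l) i μ} x∈))))
    (∈-concatMap⁻ (λ n → filter (λ y → onLadder? (suc l) (n , 1) (proj₁ y)) (iBoxes (suc l) i μ))
      (∈-ladderBoxes (suc l) i μ x box))

theorem3p8p2p1 : ∀ (ℓ : ℕ) .{{_ : NonZero ℓ}} → 3 ≤ ℓ → ∀ (i : ℕ) → i < ℓ →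
    ∀ (μ : Partition) → Regular ℓ μ →
    ladderWord ℓ i μ ≡ iSignature ℓ i μ
    × (∀ r → ReducesTo (ladderWord ℓ i μ) r ⇔ ReducesTo (iSignature ℓ i μ) r)
theorem3p8p2p1 (suc l) (s≤s 2≤l) i _ μ reg =
  words≡ , λ r → subst (λ w → ReducesTo (ladderWord (suc l) i μ) r ⇔ ReducesTo w r) words≡
                       (⇔-id _)
  where
  words≡ : ladderWord (suc l) i μ ≡ iSignature (suc l) i μ
  words≡ = cong (map proj₂) (ladderBoxes≡iBoxes l i μ (≤-trans (n≤1+n 1) 2≤l) reg)
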